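{- For the commutative ring $\mathbb{Z}_{pqr}$ with primes $p<q<r$, the independence polynomial of $\varGamma(\mathbb{Z}_{pqr})$ is $$\begin{aligned} I(\varGamma(\mathbb{Z}_{pqr}),x)=\;&(1+x)^{pq+qr+pr-2(p+q+r)+3}+(1+x)^{(p-1)(q+r-1)}-(1+x)^{(p-1)(q+r-2)}\\ &+(1+x)^{(q-1)(p+r-1)}-(1+x)^{(q-1)(p+r-2)}+(1+x)^{(r-1)(p+q-1)}\\ &-(1+x)^{(r-1)(p+q-2)}. \end{aligned}$$
   Context: For a positive integer $n$, the zero divisor graph $\varGamma(\mathbb{Z}_n)$ is the simple undirected graph whose vertices are the non-zero zero divisors of the ring $\mathbb{Z}_n$ of integers modulo $n$ (non-zero $a$ such that $ab=0$ for some non-zero $b$), two distinct vertices $a,b$ being adjacent if and only if $ab=0$ in $\mathbb{Z}_n$. An independent set of a finite graph $G$ is a set of vertices no two of which are adjacent (the empty set included); $\alpha(G)$ is the maximum size of an independent set, and $s_k(G)$ is the number of independent sets of size $k$. The independence polynomial of $G$ is $I(G,x)=\sum_{k=0}^{\alpha(G)} s_k(G)x^k$. -}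

module Defs where

open import Level using (0ℓ)
open import Data.Fin using (Fin)
import Data.Fin as Fin
open import Data.Fin.Properties using (all?; any?)
open import Data.Fin.Subset using (Subset; inside; outside; _∈_; ∣_∣)
open import Data.Fin.Subset.Properties using (_∈?_)
open import Data.Integer using (ℤ; +_)
import Data.Integer as ℤ
open import Data.List using (List; []; _∷_; _++_; map; filter; length; upTo)
open import Data.List.Extrema.Nat using (max)
open import Data.Nat using (ℕ; zero; suc; _*_; NonZero)
import Data.Nat as ℕ
open import Data.Nat.DivMod using (_mod_)
open import Data.Nat.Primality using (Prime; prime⇒nonZero)
open import Data.Nat.Properties using (*-comm; m*n≢0)
open import Data.Product using (∃; _×_; _,_; proj₁)
import Data.Vec as Vec
open import Function using (_∘_)
open import Relation.Binary using (Rel; Decidable; Symmetric; Irreflexive)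
open import Relation.Binary.PropositionalEquality using (_≡_; _≢_; refl; sym; trans; cong)
open import Relation.Nullary using (¬_; ¬?; _×-dec_; _→-dec_)
open import Relation.Unary using (Pred)
import Relation.Unary as U

-- ℤ[x].  A list holds the coefficients of x⁰, x¹, x², …; trailing zeros
-- are allowed, so equality of polynomials is _≈ₚ_ rather than _≡_.

Poly : Set
Poly = List ℤ

coeff : Poly → ℕ → ℤ
coeff []      _       = + 0
coeff (a ∷ f) zero    = a
coeff (a ∷ f) (suc k) = coeff f k

infix  4 _≈ₚ_
infixl 6 _+ₚ_ _-ₚ_
infixl 7 _*ₚ_
infixr 8 _^ₚ_

_≈ₚ_ : Rel Poly 0ℓ
f ≈ₚ g = ∀ k → coeff f k ≡ coeff g k

1ₚ : Poly
1ₚ = + 1 ∷ []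

X : Poly
X = + 0 ∷ + 1 ∷ []

_+ₚ_ : Poly → Poly → Poly
[]      +ₚ g       = g
(a ∷ f) +ₚ []      = a ∷ f
(a ∷ f) +ₚ (b ∷ g) = (a ℤ.+ b) ∷ (f +ₚ g)

_-ₚ_ : Poly → Poly → Poly
f -ₚ g = f +ₚ map ℤ.-_ g

-- (a + x f) g = a g + x (f g)
_*ₚ_ : Poly → Poly → Poly
[]      *ₚ g = []
(a ∷ f) *ₚ g = map (a ℤ.*_) g +ₚ (+ 0 ∷ f *ₚ g)

_^ₚ_ : Poly → ℕ → Poly
f ^ₚ zero  = 1ₚ
f ^ₚ suc m = f *ₚ f ^ₚ m

-- A finite simple graph whose vertices are those elements of Fin n that
-- satisfy Vertex.  The values of Adj outside Vertex play no role.

record Graph (n : ℕ) : Set₁ where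
  field
    Vertex    : Pred (Fin n) 0ℓ
    Adj       : Rel (Fin n) 0ℓ
    vertex?   : U.Decidable Vertex
    adj?      : Decidable Adj
    adjSym    : Symmetric Adj
    adjIrrefl : Irreflexive _≡_ Adj

open Graph public

Independent : ∀ {n} → Graph n → Pred (Subset n) 0ℓ
Independent G S =
  (∀ v → v ∈ S → Vertex G v) ×
  (∀ u v → u ∈ S → v ∈ S → ¬ Adj G u v)

independent? : ∀ {n} (G : Graph n) → U.Decidable (Independent G)
independent? G S =
  all? (λ v → v ∈? S →-dec vertex? G v) ×-dec
  all? (λ u → all? (λ v → u ∈? S →-dec (v ∈? S →-dec ¬? (adj? G u v))))

-- Every subset of Fin n, listed exactly once.
subsets : ∀ n → List (Subset n)
subsets zero    = Vec.[] ∷ []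
subsets (suc n) =
  map (outside Vec.∷_) (subsets n) ++ map (inside Vec.∷_) (subsets n)

independentSets : ∀ {n} → Graph n → List (Subset n)
independentSets G = filter (independent? G) (subsets _)

α : ∀ {n} → Graph n → ℕ
α G = max 0 (map ∣_∣ (independentSets G))

s : ∀ {n} → ℕ → Graph n → ℕ
s k G = length (filter (λ S → ∣ S ∣ ℕ.≟ k) (independentSets G))

-- The coefficient list s₀, …, s_α, that is, Σ_{k=0}^{α(G)} s_k(G) xᵏ.
I : ∀ {n} → Graph n → Poly
I G = map (λ k → + s k G) (upTo (suc (α G)))

-- ℤₙ is represented by Fin n, each class by its least residue.
module ℤ-mod (n : ℕ) .{{_ : NonZero n}} where

  0ₙ : Fin n
  0ₙ = 0 mod n

  infixl 7 _*ₙ_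
  _*ₙ_ : Fin n → Fin n → Fin n
  a *ₙ b = (Fin.toℕ a * Fin.toℕ b) mod n

  *ₙ-comm : ∀ a b → a *ₙ b ≡ b *ₙ a
  *ₙ-comm a b = cong (_mod n) (*-comm (Fin.toℕ a) (Fin.toℕ b))

  NonzeroZeroDivisor : Pred (Fin n) 0ℓ
  NonzeroZeroDivisor a = a ≢ 0ₙ × ∃ λ b → b ≢ 0ₙ × a *ₙ b ≡ 0ₙ

  nonzeroZeroDivisor? : U.Decidable NonzeroZeroDivisor
  nonzeroZeroDivisor? a =
    ¬? (a Fin.≟ 0ₙ) ×-dec
    any? (λ b → ¬? (b Fin.≟ 0ₙ) ×-dec (a *ₙ b Fin.≟ 0ₙ))

-- The zero divisor graph of ℤₙ.
Γℤ : ∀ n .{{_ : NonZero n}} → Graph n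
Γℤ n = record
  { Vertex    = NonzeroZeroDivisor
  ; Adj       = λ a b → a ≢ b × a *ₙ b ≡ 0ₙ
  ; vertex?   = nonzeroZeroDivisor?
  ; adj?      = λ a b → ¬? (a Fin.≟ b) ×-dec (a *ₙ b Fin.≟ 0ₙ)
  ; adjSym    = λ {a} {b} (a≢b , ab≡0) → a≢b ∘ sym , trans (*ₙ-comm b a) ab≡0
  ; adjIrrefl = λ a≡b adj → proj₁ adj a≡b
  }
  where open ℤ-mod n

pqr≢0 : ∀ {p q r} → Prime p → Prime q → Prime r → NonZero (p * q * r)
pqr≢0 {p} {q} {r} pPrime qPrime rPrime = m*n≢0 (p * q) r
  where
  instance
    _ = prime⇒nonZero pPrime
    _ = prime⇒nonZero qPrime
    _ = prime⇒nonZero rPrime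
    _ = m*n≢0 p q

{-# OPTIONS --safe #-}
module Submission where

-- Send a ∈ ℤₙ (n = pqr) to the set σ a of those of the three primes that divide a.  Then a is a
-- vertex iff σ a is nonempty and proper, and distinct a, b are adjacent iff σ a ∪ σ b is
-- everything.  Hence a vertex divisible by the two primes other than i forces every member of an
-- independent set S to be prime to i, and S is independent iff either S ⊆ U, the vertices
-- divisible by exactly one prime, or S ⊆ V i, the vertices prime to i, for one of the primes i.
-- Two of the V i meet inside U, so with W i = U ∩ V i counting subsets gives
-- s_k + Σᵢ C(|W i|, k) = C(|U|, k) + Σᵢ C(|V i|, k).

open import Defs
open import Data.Bool using (Bool; true; false; _∧_; if_then_else_)
import Data.Bool.Properties as Bool
open import Data.Empty using (⊥-elim)
open import Data.Fin using (Fin; zero; suc; toℕ; fromℕ<; punchIn)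
import Data.Fin as Fin
open import Data.Fin.Properties using
  (any?; all?; toℕ-injective; toℕ<n; toℕ-fromℕ<; punchInᵢ≢i)
open import Data.Fin.Subset using
  (Subset; inside; outside; _∈_; _∉_; _⊆_; ∣_∣; ⁅_⁆; ∁; _∪_; ⊤; Nonempty)
open import Data.Fin.Subset.Properties using
  ( _∈?_; _⊆?_; nonempty?; anySubset?; ⊆-antisym; ⊆⊤; ∈⊤; drop-∷-⊆
  ; ∪-idem; ∪-identityˡ; Empty-unique)
open import Data.Integer using (ℤ) renaming (+_ to pos)
import Data.Integer as ℤ
import Data.Integer.Properties as ℤ
import Data.Integer.Tactic.RingSolver as ℤ-Solver
open import Data.List using (List; []; _∷_; _++_; map; filter; length; applyUpTo)
open import Data.List.Extrema.Nat using (xs≤max)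
open import Data.List.Properties using (map-upTo; map-++; map-∘; map-cong; filter-none)
import Data.List.Relation.Unary.All as Listᴬ
open import Data.List.Relation.Unary.All.Properties using (map⁻)
open import Data.Nat using
  ( ℕ; zero; suc; _+_; _*_; _∸_; _≤_; _<_; NonZero; z≤n; s≤s; _≟_; _<?_
  ; >-nonZero; >-nonZero⁻¹; nonTrivial⇒n>1)
open import Data.Nat.Combinatorics using (_C_; nCk+nC[k+1]≡[n+1]C[k+1])
open import Data.Nat.Coprimality using (Coprime; coprime-divisor; prime⇒coprime)
  renaming (sym to coprime-sym)
open import Data.Nat.DivMod using (_mod_)
open import Data.Nat.Divisibility
open import Data.Nat.ListAction using (sum)
open import Data.Nat.ListAction.Properties using (sum-++)
open import Data.Nat.Primality using (Prime; euclidsLemma; prime⇒nonZero; prime⇒nonTrivial)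
open import Data.Nat.Properties
import Data.Nat.Tactic.RingSolver as ℕ-Solver
open import Data.Product using (∃; _×_; _,_; proj₁; proj₂)
open import Data.Sum using ([_,_]′)
open import Data.Vec using (Vec; []; _∷_; here; there)
import Data.Vec as Vec
import Data.Vec.Properties as Vec
open import Data.Vec.Relation.Unary.All using (All; []; _∷_)
open import Data.Vec.Relation.Unary.AllPairs using (AllPairs; []; _∷_)
open import Function using (_∘_; _⇔_; mk⇔; Equivalence)
open import Level using (0ℓ)
open import Relation.Binary.PropositionalEquality
open import Relation.Nullary
open import Relation.Nullary.Decidable using
  (does-⇔; from-yes; decidable-stable; dec-true; dec-false)
open import Relation.Unary using (Pred; Decidable)
open import Algebra.Properties.CommutativeMonoid.Sum +-0-commutativeMonoid
  using (sum-remove; ∑-distrib-+; ∑-comm; sum-cong-≗; sum-replicate-zero)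
  renaming (sum to ∑)

-- Coefficients of polynomials: sums, powers of 1 + x, and `I`.

coeff-+ₚ : ∀ f g k → coeff (f +ₚ g) k ≡ coeff f k ℤ.+ coeff g k
coeff-+ₚ []      g       k       = sym (ℤ.+-identityˡ _)
coeff-+ₚ (a ∷ f) []      k       = sym (ℤ.+-identityʳ _)
coeff-+ₚ (a ∷ f) (b ∷ g) zero    = refl
coeff-+ₚ (a ∷ f) (b ∷ g) (suc k) = coeff-+ₚ f g k

coeff-map : ∀ (h : ℤ → ℤ) → h (pos 0) ≡ pos 0 → ∀ f k → coeff (map h f) k ≡ h (coeff f k)
coeff-map h h0 []      k       = sym h0
coeff-map h h0 (a ∷ f) zero    = refl
coeff-map h h0 (a ∷ f) (suc k) = coeff-map h h0 f k

coeff--ₚ : ∀ f g k → coeff (f -ₚ g) k ≡ coeff f k ℤ.- coeff g k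
coeff--ₚ f g k = trans (coeff-+ₚ f _ k) (cong (λ c → coeff f k ℤ.+ c) (coeff-map ℤ.-_ refl g k))

coeff-0 : ∀ k → coeff (pos 0 ∷ []) k ≡ pos 0
coeff-0 zero    = refl
coeff-0 (suc k) = refl

coeff-1* : ∀ f k → coeff (map (pos 1 ℤ.*_) f) k ≡ coeff f k
coeff-1* f k = trans (coeff-map (pos 1 ℤ.*_) refl f k) (ℤ.*-identityˡ _)

-- The binomial theorem, by induction on `m` with Pascal's rule.
coeff-[1+X]^ : ∀ m k → coeff ((1ₚ +ₚ X) ^ₚ m) k ≡ pos (m C k)
coeff-[1+X]^ zero    zero    = refl
coeff-[1+X]^ zero    (suc k) = refl
coeff-[1+X]^ (suc m) k       = trans (coeff-+ₚ (map (pos 1 ℤ.*_) g) _ k) (step k)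
  where
  g = (1ₚ +ₚ X) ^ₚ m
  -- This is how (1 + x) g unfolds: 1 · g plus x times (1 · g + 0).
  step : ∀ k → coeff (map (pos 1 ℤ.*_) g) k ℤ.+ coeff (pos 0 ∷ (map (pos 1 ℤ.*_) g +ₚ (pos 0 ∷ []))) k
             ≡ pos (suc m C k)
  step zero = cong (ℤ._+ pos 0) (trans (coeff-1* g 0) (coeff-[1+X]^ m 0))
  step (suc k) = begin
    coeff (map (pos 1 ℤ.*_) g) (suc k) ℤ.+ coeff (map (pos 1 ℤ.*_) g +ₚ (pos 0 ∷ [])) k
      ≡⟨ cong₂ ℤ._+_ (trans (coeff-1* g (suc k)) (coeff-[1+X]^ m (suc k)))
                     (coeff-+ₚ (map (pos 1 ℤ.*_) g) _ k) ⟩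
    pos (m C suc k) ℤ.+ (coeff (map (pos 1 ℤ.*_) g) k ℤ.+ coeff (pos 0 ∷ []) k)
      ≡⟨ cong₂ (λ x y → pos (m C suc k) ℤ.+ (x ℤ.+ y))
               (trans (coeff-1* g k) (coeff-[1+X]^ m k)) (coeff-0 k) ⟩
    pos (m C suc k + (m C k + 0))
      ≡⟨ cong pos (trans (+-comm (m C suc k) _) (cong (_+ m C suc k) (+-identityʳ _))) ⟩
    pos (m C k + m C suc k)
      ≡⟨ cong pos (nCk+nC[k+1]≡[n+1]C[k+1] m k) ⟩
    pos (suc m C suc k) ∎
    where open ≡-Reasoning

-- Being left associative, three uses starting from a power of 1 + x unfold to exactly the
-- seven-term expression of the theorem.
_+[1+X]^_-[1+X]^_ : Poly → ℕ → ℕ → Poly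
f +[1+X]^ v -[1+X]^ w = f +ₚ (1ₚ +ₚ X) ^ₚ v -ₚ (1ₚ +ₚ X) ^ₚ w

infixl 6 _+[1+X]^_-[1+X]^_

coeff-+[1+X]^-[1+X]^ : ∀ f v w k →
  coeff (f +[1+X]^ v -[1+X]^ w) k ≡ coeff f k ℤ.+ pos (v C k) ℤ.- pos (w C k)
coeff-+[1+X]^-[1+X]^ f v w k = trans (coeff--ₚ (f +ₚ (1ₚ +ₚ X) ^ₚ v) _ k)
  (cong₂ ℤ._-_ (trans (coeff-+ₚ f _ k) (cong (λ c → coeff f k ℤ.+ c) (coeff-[1+X]^ v k)))
               (coeff-[1+X]^ w k))

-- The counting identity lives in ℕ without subtraction; passing to ℤ moves the `w` terms across.
-- Each `+ 0` is the end of an unfolded `∑` over `Fin 3`.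
isolate : ∀ s w₀ w₁ w₂ u v₀ v₁ v₂ →
  s + (w₀ + (w₁ + (w₂ + 0))) ≡ u + (v₀ + (v₁ + (v₂ + 0))) →
  pos s ≡ pos u ℤ.+ pos v₀ ℤ.- pos w₀ ℤ.+ pos v₁ ℤ.- pos w₁ ℤ.+ pos v₂ ℤ.- pos w₂
isolate s w₀ w₁ w₂ u v₀ v₁ v₂ eq = begin
  pos s
    ≡⟨ cancel (pos s) (pos w₀) (pos w₁) (pos w₂) ⟩
  pos (s + (w₀ + (w₁ + (w₂ + 0)))) ℤ.- pos w₀ ℤ.- pos w₁ ℤ.- pos w₂
    ≡⟨ cong (λ x → pos x ℤ.- pos w₀ ℤ.- pos w₁ ℤ.- pos w₂) eq ⟩
  pos (u + (v₀ + (v₁ + (v₂ + 0)))) ℤ.- pos w₀ ℤ.- pos w₁ ℤ.- pos w₂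
    ≡⟨ rearrange (pos u) (pos v₀) (pos v₁) (pos v₂) (pos w₀) (pos w₁) (pos w₂) ⟩
  pos u ℤ.+ pos v₀ ℤ.- pos w₀ ℤ.+ pos v₁ ℤ.- pos w₁ ℤ.+ pos v₂ ℤ.- pos w₂ ∎
  where
  open ≡-Reasoning
  cancel : ∀ s w₀ w₁ w₂ →
    s ≡ s ℤ.+ (w₀ ℤ.+ (w₁ ℤ.+ (w₂ ℤ.+ pos 0))) ℤ.- w₀ ℤ.- w₁ ℤ.- w₂
  cancel = ℤ-Solver.solve-∀
  rearrange : ∀ u v₀ v₁ v₂ w₀ w₁ w₂ →
    u ℤ.+ (v₀ ℤ.+ (v₁ ℤ.+ (v₂ ℤ.+ pos 0))) ℤ.- w₀ ℤ.- w₁ ℤ.- w₂ ≡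
    u ℤ.+ v₀ ℤ.- w₀ ℤ.+ v₁ ℤ.- w₁ ℤ.+ v₂ ℤ.- w₂
  rearrange = ℤ-Solver.solve-∀

coeff-applyUpTo-< : ∀ (f : ℕ → ℤ) {k m} → k < m → coeff (applyUpTo f m) k ≡ f k
coeff-applyUpTo-< f {zero}  (s≤s _)   = refl
coeff-applyUpTo-< f {suc k} (s≤s k<m) = coeff-applyUpTo-< (f ∘ suc) k<m

coeff-applyUpTo-≥ : ∀ (f : ℕ → ℤ) {k m} → m ≤ k → coeff (applyUpTo f m) k ≡ pos 0
coeff-applyUpTo-≥ f z≤n       = refl
coeff-applyUpTo-≥ f (s≤s m≤k) = coeff-applyUpTo-≥ (f ∘ suc) m≤k

s≡0 : ∀ {n} (G : Graph n) {k} → α G < k → s k G ≡ 0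
s≡0 G {k} α<k = cong length (filter-none (λ S → ∣ S ∣ ≟ k)
  (Listᴬ.map (λ ∣S∣≤α ∣S∣≡k → <⇒≱ α<k (subst (_≤ α G) ∣S∣≡k ∣S∣≤α))
           (map⁻ (xs≤max 0 (map ∣_∣ (independentSets G))))))

-- The list stops at degree `α G`. Beyond it the coefficient defaults to 0, which is still the right
-- count by `s≡0`.
coeff-I : ∀ {n} (G : Graph n) k → coeff (I G) k ≡ pos (s k G)
coeff-I G k = trans (cong (λ f → coeff f k) (map-upTo (λ k → pos (s k G)) (suc (α G)))) value
  where
  value : coeff (applyUpTo (λ k → pos (s k G)) (suc (α G))) k ≡ pos (s k G)
  value with k <? suc (α G)
  ... | yes k≤α = coeff-applyUpTo-< (λ k → pos (s k G)) k≤α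
  ... | no  k≰α = trans (coeff-applyUpTo-≥ (λ k → pos (s k G)) (≮⇒≥ k≰α))
                        (cong pos (sym (s≡0 G (≮⇒≥ k≰α))))

-- Indicators, and finite sums over `Fin n` and over lists.

-- The Iverson bracket. It depends on `does` alone, so that on `_×-dec_` it reduces to a Boolean
-- conjunction.
⟦_⟧ : {A : Set} → Dec A → ℕ
⟦ a? ⟧ = if does a? then 1 else 0

⟦⟧-cong : {A B : Set} (a? : Dec A) (b? : Dec B) → (A → B) → (B → A) → ⟦ a? ⟧ ≡ ⟦ b? ⟧
⟦⟧-cong a? b? A⇒B B⇒A = cong (if_then 1 else 0) (does-⇔ (mk⇔ A⇒B B⇒A) a? b?)

⟦⟧-yes : {A : Set} (a? : Dec A) → A → ⟦ a? ⟧ ≡ 1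
⟦⟧-yes a? a = cong (if_then 1 else 0) (dec-true a? a)

⟦⟧-no : {A : Set} (a? : Dec A) → ¬ A → ⟦ a? ⟧ ≡ 0
⟦⟧-no a? ¬a = cong (if_then 1 else 0) (dec-false a? ¬a)

∑-only : ∀ {n} (f : Fin n → ℕ) i → (∀ j → j ≢ i → f j ≡ 0) → ∑ f ≡ f i
∑-only {suc n} f i f≡0 = begin
  ∑ f                      ≡⟨ sum-remove f ⟩
  f i + ∑ (f ∘ punchIn i)
    ≡⟨ cong (f i +_) (trans (sum-cong-≗ (λ j → f≡0 _ (punchInᵢ≢i i j))) (sum-replicate-zero n)) ⟩
  f i + 0                  ≡⟨ +-identityʳ _ ⟩
  f i                      ∎
  where open ≡-Reasoning

∑ₗ : {A : Set} → List A → (A → ℕ) → ℕ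
∑ₗ xs f = sum (map f xs)

∑ₗ-cong : {A : Set} (xs : List A) {f g : A → ℕ} → (∀ x → f x ≡ g x) → ∑ₗ xs f ≡ ∑ₗ xs g
∑ₗ-cong xs f≗g = cong sum (map-cong f≗g xs)

∑ₗ-0 : {A : Set} (xs : List A) → ∑ₗ xs (λ _ → 0) ≡ 0
∑ₗ-0 []       = refl
∑ₗ-0 (x ∷ xs) = ∑ₗ-0 xs

∑ₗ-+ : {A : Set} (xs : List A) (f g : A → ℕ) → ∑ₗ xs (λ x → f x + g x) ≡ ∑ₗ xs f + ∑ₗ xs g
∑ₗ-+ []       f g = refl
∑ₗ-+ (x ∷ xs) f g = trans (cong (f x + g x +_) (∑ₗ-+ xs f g))
  (interchange (f x) (g x) (∑ₗ xs f) (∑ₗ xs g))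
  where open import Algebra.Properties.CommutativeSemigroup +-commutativeSemigroup

∑ₗ-∑-comm : {A : Set} {n : ℕ} (xs : List A) (f : Fin n → A → ℕ) →
  ∑ₗ xs (λ x → ∑ (λ i → f i x)) ≡ ∑ (λ i → ∑ₗ xs (f i))
∑ₗ-∑-comm {n = n} [] f = sym (sum-replicate-zero n)
∑ₗ-∑-comm (x ∷ xs) f = trans (cong (∑ (λ i → f i x) +_) (∑ₗ-∑-comm xs f))
  (sym (∑-distrib-+ (λ i → f i x) (λ i → ∑ₗ xs (f i))))

-- Turns `s k G`, by definition the length of a doubly filtered list, into a sum of indicators.
length-filter₂ : {A : Set} {P Q : Pred A 0ℓ} (P? : Decidable P) (Q? : Decidable Q) (xs : List A) →
  length (filter P? (filter Q? xs)) ≡ ∑ₗ xs (λ x → ⟦ P? x ×-dec Q? x ⟧)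
length-filter₂ P? Q? [] = refl
length-filter₂ P? Q? (x ∷ xs) with does (Q? x)
... | false rewrite Bool.∧-zeroʳ (does (P? x)) = length-filter₂ P? Q? xs
... | true rewrite Bool.∧-identityʳ (does (P? x)) with does (P? x)
...   | false = length-filter₂ P? Q? xs
...   | true  = cong suc (length-filter₂ P? Q? xs)

-- Counting the subsets of given size inside a fixed set.

∑ₛ : ∀ {n} → (Subset n → ℕ) → ℕ
∑ₛ = ∑ₗ (subsets _)

∑ₛ-suc : ∀ {n} (f : Subset (suc n) → ℕ) →
  ∑ₛ f ≡ ∑ₛ (f ∘ (outside ∷_)) + ∑ₛ (f ∘ (inside ∷_))
∑ₛ-suc {n} f = begin
  sum (map f (map (outside ∷_) (subsets n) ++ map (inside ∷_) (subsets n)))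
    ≡⟨ cong sum (map-++ f (map (outside ∷_) (subsets n)) _) ⟩
  sum (map f (map (outside ∷_) (subsets n)) ++ map f (map (inside ∷_) (subsets n)))
    ≡⟨ sum-++ (map f (map (outside ∷_) (subsets n))) _ ⟩
  sum (map f (map (outside ∷_) (subsets n))) + sum (map f (map (inside ∷_) (subsets n)))
    ≡⟨ cong₂ (λ xs ys → sum xs + sum ys) (map-∘ (subsets n)) (map-∘ (subsets n)) ⟨
  ∑ₛ (f ∘ (outside ∷_)) + ∑ₛ (f ∘ (inside ∷_)) ∎
  where open ≡-Reasoning

sized⊆? : ∀ {n} (U : Subset n) k (S : Subset n) → Dec (∣ S ∣ ≡ k × S ⊆ U)
sized⊆? U k S = (∣ S ∣ ≟ k) ×-dec (S ⊆? U)

-- Split by whether `S` contains the first point. If that point lies in `U`, the two halves are the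
-- two terms of Pascal's rule; if not, the second half is empty.
∑ₛ-⊆ : ∀ {n} (U : Subset n) k → ∑ₛ (λ S → ⟦ sized⊆? U k S ⟧) ≡ ∣ U ∣ C k
∑ₛ-⊆ [] zero    = refl
∑ₛ-⊆ [] (suc k) = refl
∑ₛ-⊆ {suc n} (u ∷ U) k = begin
  ∑ₛ (λ S → ⟦ sized⊆? (u ∷ U) k S ⟧)
    ≡⟨ ∑ₛ-suc (λ S → ⟦ sized⊆? (u ∷ U) k S ⟧) ⟩
  ∑ₛ (λ S → ⟦ sized⊆? (u ∷ U) k (outside ∷ S) ⟧)
    + ∑ₛ (λ S → ⟦ sized⊆? (u ∷ U) k (inside ∷ S) ⟧)
    -- An `outside` head affects neither size nor inclusion, so the induction hypothesis applies as
    -- it stands.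
    ≡⟨ cong (_+ ∑ₛ (λ S → ⟦ sized⊆? (u ∷ U) k (inside ∷ S) ⟧)) (∑ₛ-⊆ U k) ⟩
  ∣ U ∣ C k + ∑ₛ (λ S → ⟦ sized⊆? (u ∷ U) k (inside ∷ S) ⟧)
    ≡⟨ with-inside u k ⟩
  ∣ u ∷ U ∣ C k ∎
  where
  open ≡-Reasoning
  none : ∀ {P : Pred (Subset n) 0ℓ} (P? : Decidable P) → (∀ S → does (P? S) ≡ false) →
    ∑ₛ (⟦_⟧ ∘ P?) ≡ 0
  none P? P≡false = trans (∑ₗ-cong (subsets n) (λ S → cong (if_then 1 else 0) (P≡false S)))
    (∑ₗ-0 (subsets n))
  with-inside : ∀ u k →
    ∣ U ∣ C k + ∑ₛ (λ S → ⟦ sized⊆? (u ∷ U) k (inside ∷ S) ⟧) ≡ ∣ u ∷ U ∣ C k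
  with-inside outside k = trans
    (cong (∣ U ∣ C k +_) (none (sized⊆? (outside ∷ U) k ∘ (inside ∷_))
      (λ S → Bool.∧-zeroʳ (does (suc ∣ S ∣ ≟ k)))))
    (+-identityʳ _)
  with-inside inside zero = trans
    (cong (∣ U ∣ C 0 +_) (none (sized⊆? (inside ∷ U) 0 ∘ (inside ∷_)) (λ _ → refl)))
    (+-identityʳ _)
  with-inside inside (suc k) = begin
    ∣ U ∣ C suc k + ∑ₛ (λ S → ⟦ sized⊆? (inside ∷ U) (suc k) (inside ∷ S) ⟧)
      ≡⟨ cong (∣ U ∣ C suc k +_) (∑ₛ-⊆ U k) ⟩
    ∣ U ∣ C suc k + ∣ U ∣ C k
      ≡⟨ +-comm (∣ U ∣ C suc k) _ ⟩
    ∣ U ∣ C k + ∣ U ∣ C suc k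
      ≡⟨ nCk+nC[k+1]≡[n+1]C[k+1] ∣ U ∣ k ⟩
    suc ∣ U ∣ C suc k ∎

-- Facts about subsets of a three-element set, decided by enumeration.

allSubsets? : ∀ {n} {P : Pred (Subset n) 0ℓ} → Decidable P → Dec (∀ t → P t)
allSubsets? P? with anySubset? (¬? ∘ P?)
... | yes (t , ¬Pt) = no (λ ∀P → ¬Pt (∀P t))
... | no  ∄¬P       = yes (λ t → decidable-stable (P? t) (λ ¬Pt → ∄¬P (t , ¬Pt)))

_≟ₛ_ : ∀ {n} (t u : Subset n) → Dec (t ≡ u)
_≟ₛ_ = Vec.≡-dec Bool._≟_

-- When `t` is the set of primes dividing a residue, `Singleton`, `NonemptyWithout i`,
-- `SingletonWithout i` and `Proper` describe U, V i, W i and the vertex set.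
Singleton : ∀ {m} → Pred (Subset m) 0ℓ
Singleton t = ∣ t ∣ ≡ 1

singleton? : ∀ {m} → Decidable (Singleton {m})
singleton? t = ∣ t ∣ ≟ 1

NonemptyWithout : ∀ {m} → Fin m → Pred (Subset m) 0ℓ
NonemptyWithout i t = i ∉ t × Nonempty t

nonemptyWithout? : ∀ {m} (i : Fin m) → Decidable (NonemptyWithout i)
nonemptyWithout? i t = ¬? (i ∈? t) ×-dec nonempty? t

SingletonWithout : ∀ {m} → Fin m → Pred (Subset m) 0ℓ
SingletonWithout i t = i ∉ t × Singleton t

singletonWithout? : ∀ {m} (i : Fin m) → Decidable (SingletonWithout i)
singletonWithout? i t = ¬? (i ∈? t) ×-dec singleton? t

Proper : ∀ {m} → Pred (Subset m) 0ℓ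
Proper t = Nonempty t × t ≢ ⊤

proper? : ∀ {m} → Decidable (Proper {m})
proper? t = nonempty? t ×-dec ¬? (t ≟ₛ ⊤)

singleton⇒proper : (t : Subset 3) → Singleton t → Proper t
singleton⇒proper = from-yes (allSubsets? (λ (t : Subset 3) → singleton? t →-dec proper? t))

-- Two singletons cover at most two of the three points.
singleton∪singleton≢⊤ : (t u : Subset 3) → Singleton t → Singleton u → t ∪ u ≢ ⊤
singleton∪singleton≢⊤ = from-yes (allSubsets? (λ (t : Subset 3) → allSubsets? (λ (u : Subset 3) →
  singleton? t →-dec (singleton? u →-dec ¬? ((t ∪ u) ≟ₛ ⊤)))))

nonemptyWithout⇒proper : (i : Fin 3) (t : Subset 3) → NonemptyWithout i t → Proper t
nonemptyWithout⇒proper = from-yes (all? (λ (i : Fin 3) → allSubsets? (λ (t : Subset 3) →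
  nonemptyWithout? i t →-dec proper? t)))

-- The point `i` stays uncovered.
without∪without≢⊤ : (i : Fin 3) (t u : Subset 3) →
  NonemptyWithout i t → NonemptyWithout i u → t ∪ u ≢ ⊤
without∪without≢⊤ = from-yes (all? (λ (i : Fin 3) → allSubsets? (λ (t : Subset 3) → allSubsets? (λ (u : Subset 3) →
  nonemptyWithout? i t →-dec (nonemptyWithout? i u →-dec ¬? ((t ∪ u) ≟ₛ ⊤))))))

-- Once `i` and `j` are excluded, a single point is left.
without₂⇒singleton : (i j : Fin 3) (t : Subset 3) → j ≢ i →
  NonemptyWithout i t → NonemptyWithout j t → Singleton t
without₂⇒singleton = from-yes (all? (λ (i : Fin 3) → all? (λ (j : Fin 3) → allSubsets? (λ (t : Subset 3) →
  ¬? (j Fin.≟ i) →-dec (nonemptyWithout? i t →-dec (nonemptyWithout? j t →-dec singleton? t))))))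

-- A proper non-singleton subset of Fin 3 is the complement of some ⁅ i ⁆.
nonsingleton⇒without : (t : Subset 3) → Proper t → ¬ Singleton t →
  ∃ λ i → ∀ u → Proper u → t ∪ u ≢ ⊤ → NonemptyWithout i u
nonsingleton⇒without = from-yes (allSubsets? (λ (t : Subset 3) →
  proper? t →-dec (¬? (singleton? t) →-dec any? (λ (i : Fin 3) → allSubsets? (λ (u : Subset 3) →
    proper? u →-dec (¬? ((t ∪ u) ≟ₛ ⊤) →-dec nonemptyWithout? i u))))))

-- Preimages of families of subsets under a map from `Fin n`.

module _ {n m : ℕ} (σ : Fin n → Subset m) where

  preimage : {P : Pred (Subset m) 0ℓ} → Decidable P → Subset n
  preimage P? = Vec.tabulate (does ∘ P? ∘ σ)

  ∈-preimage : {P : Pred (Subset m) 0ℓ} (P? : Decidable P) {a : Fin n} → a ∈ preimage P? ⇔ P (σ a)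
  ∈-preimage P? {a} = mk⇔
    (λ a∈ → decide (P? (σ a)) (trans (sym (Vec.lookup∘tabulate _ a)) (Vec.[]=⇒lookup a∈)))
    (λ Pa → Vec.lookup⇒[]= a _ (trans (Vec.lookup∘tabulate _ a) (dec-true (P? (σ a)) Pa)))
    where
    decide : ∀ {A : Set} (a? : Dec A) → does a? ≡ true → A
    decide (yes a) refl = a

  ⊆-preimage⁺ : {P : Pred (Subset m) 0ℓ} (P? : Decidable P) {S : Subset n} →
    (∀ {a} → a ∈ S → P (σ a)) → S ⊆ preimage P?
  ⊆-preimage⁺ P? S⇒P a∈S = Equivalence.from (∈-preimage P?) (S⇒P a∈S)

  ⊆-preimage⁻ : {P : Pred (Subset m) 0ℓ} (P? : Decidable P) {S : Subset n} →
    S ⊆ preimage P? → ∀ {a} → a ∈ S → P (σ a)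
  ⊆-preimage⁻ P? S⊆ a∈S = Equivalence.to (∈-preimage P?) (S⊆ a∈S)

  ∣preimage∣ : {P : Pred (Subset m) 0ℓ} (P? : Decidable P) →
    ∣ preimage P? ∣ ≡ ∑ (λ a → ⟦ P? (σ a) ⟧)
  ∣preimage∣ P? = ∣tabulate∣ (does ∘ P? ∘ σ)
    where
    ∣tabulate∣ : ∀ {n} (f : Fin n → Bool) →
      ∣ Vec.tabulate f ∣ ≡ ∑ (λ a → if f a then 1 else 0)
    ∣tabulate∣ {zero}  f = refl
    ∣tabulate∣ {suc n} f with f zero
    ... | true  = cong suc (∣tabulate∣ (f ∘ suc))
    ... | false = ∣tabulate∣ (f ∘ suc)

-- Independent sets of a graph in which adjacency means covering three points.

module _ {n : ℕ} (G : Graph n) (σ : Fin n → Subset 3)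
  (vertex⇔ : ∀ {a} → Vertex G a ⇔ Proper (σ a))
  (adj⇔ : ∀ {a b} → Adj G a b ⇔ (a ≢ b × σ a ∪ σ b ≡ ⊤))
  where

  U : Subset n
  U = preimage σ singleton?

  V W : Fin 3 → Subset n
  V i = preimage σ (nonemptyWithout? i)
  W i = preimage σ (singletonWithout? i)

  -- Serves for `U` and for every `V i`: both come from a family of proper sets no two of which
  -- cover all three points.
  independent-⊆ : {P : Pred (Subset 3) 0ℓ} (P? : Decidable P) →
    (∀ t → P t → Proper t) → (∀ t u → P t → P u → t ∪ u ≢ ⊤) →
    ∀ {S} → S ⊆ preimage σ P? → Independent G S
  independent-⊆ P? P⇒proper P⇒≢⊤ S⊆ =
    (λ a a∈S → Equivalence.from vertex⇔ (P⇒proper _ (S⇒P a∈S))) ,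
    (λ a b a∈S b∈S adj → P⇒≢⊤ _ _ (S⇒P a∈S) (S⇒P b∈S) (proj₂ (Equivalence.to adj⇔ adj)))
    where
    S⇒P = λ {a} → ⊆-preimage⁻ σ P? S⊆ {a}

  -- Independence says nothing when a = b, but then the union is σ a itself, which is not `⊤`
  -- because a is a vertex.
  independent-nonadjacent : ∀ {S} → Independent G S →
    ∀ {a b} → a ∈ S → b ∈ S → σ a ∪ σ b ≢ ⊤
  independent-nonadjacent (vertices , ¬adj) {a} {b} a∈S b∈S eq with a Fin.≟ b
  ... | no a≢b = ¬adj a b a∈S b∈S (Equivalence.from adj⇔ (a≢b , eq))
  ... | yes refl = proj₂ (Equivalence.to vertex⇔ (vertices a a∈S)) (trans (sym (∪-idem (σ a))) eq)

  -- A member `a` outside `U` has σ a equal to the complement of some `⁅ i ⁆`, so every member not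
  -- covering with it, `a` included, avoids `i`.
  independent-⊈U : ∀ {S} → Independent G S → ¬ (S ⊆ U) → ∃ λ i → S ⊆ V i
  independent-⊈U {S} ind S⊈U with any? (λ a → (a ∈? S) ×-dec ¬? (singleton? (σ a)))
  ... | no ∄a = ⊥-elim (S⊈U (⊆-preimage⁺ σ singleton?
          (λ {a} a∈S → decidable-stable (singleton? (σ a)) (λ ¬single → ∄a (a , a∈S , ¬single)))))
  ... | yes (a , a∈S , ¬single) =
    let proper = λ {b} b∈S → Equivalence.to vertex⇔ (proj₁ ind b b∈S)
        i , without = nonsingleton⇒without (σ a) (proper a∈S) ¬single
    in i , ⊆-preimage⁺ σ (nonemptyWithout? i)
             (λ b∈S → without _ (proper b∈S) (independent-nonadjacent ind a∈S b∈S))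

  ⊆W⇒⊆V : ∀ i {S} → S ⊆ W i → S ⊆ V i
  ⊆W⇒⊆V i S⊆W = ⊆-preimage⁺ σ (nonemptyWithout? i) (λ a∈S →
    let i∉ , single = ⊆-preimage⁻ σ (singletonWithout? i) S⊆W a∈S
    in i∉ , proj₁ (singleton⇒proper _ single))

  ⊆W⇒⊆U : ∀ i {S} → S ⊆ W i → S ⊆ U
  ⊆W⇒⊆U i S⊆W = ⊆-preimage⁺ σ singleton? (λ a∈S →
    proj₂ (⊆-preimage⁻ σ (singletonWithout? i) S⊆W a∈S))

  ⊆V∧⊆U⇒⊆W : ∀ i {S} → S ⊆ V i → S ⊆ U → S ⊆ W i
  ⊆V∧⊆U⇒⊆W i S⊆V S⊆U = ⊆-preimage⁺ σ (singletonWithout? i) (λ a∈S →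
    proj₁ (⊆-preimage⁻ σ (nonemptyWithout? i) S⊆V a∈S) , ⊆-preimage⁻ σ singleton? S⊆U a∈S)

  -- Hence a set not inside `U` lies in at most one of the `V i`, and the sum of the three
  -- indicators is 0 or 1.
  ⊆V-exclusive : ∀ {i j S} → j ≢ i → S ⊆ V i → S ⊆ V j → S ⊆ U
  ⊆V-exclusive {i} {j} j≢i S⊆Vᵢ S⊆Vⱼ = ⊆-preimage⁺ σ singleton?
    (λ a∈S → without₂⇒singleton i j _ j≢i
      (⊆-preimage⁻ σ (nonemptyWithout? i) S⊆Vᵢ a∈S)
      (⊆-preimage⁻ σ (nonemptyWithout? j) S⊆Vⱼ a∈S))

  -- If S ⊆ U, then S is independent and the conditions S ⊆ W i and S ⊆ V i agree. Otherwise S lies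
  -- in no `W i`, and in exactly one `V i` or in none according as it is independent or not.
  indicator-identity : ∀ S →
    ⟦ independent? G S ⟧ + ∑ (λ i → ⟦ S ⊆? W i ⟧) ≡ ⟦ S ⊆? U ⟧ + ∑ (λ i → ⟦ S ⊆? V i ⟧)
  indicator-identity S = by-cases (S ⊆? U)
    where
    open ≡-Reasoning
    ⊆V⇒independent : ∀ i → S ⊆ V i → Independent G S
    ⊆V⇒independent i =
      independent-⊆ (nonemptyWithout? i) (nonemptyWithout⇒proper i) (without∪without≢⊤ i)
    outsideU : ¬ (S ⊆ U) → Dec (∃ λ i → S ⊆ V i) →
      ⟦ independent? G S ⟧ ≡ ∑ (λ i → ⟦ S ⊆? V i ⟧)
    outsideU S⊈U (yes (i , S⊆Vᵢ)) = begin
      ⟦ independent? G S ⟧    ≡⟨ ⟦⟧-yes (independent? G S) (⊆V⇒independent i S⊆Vᵢ) ⟩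
      1                       ≡⟨ ⟦⟧-yes (S ⊆? V i) S⊆Vᵢ ⟨
      ⟦ S ⊆? V i ⟧            ≡⟨ ∑-only (λ i → ⟦ S ⊆? V i ⟧) i (λ j j≢i →
                                   ⟦⟧-no (S ⊆? V j) (λ S⊆Vⱼ → S⊈U (⊆V-exclusive j≢i S⊆Vᵢ S⊆Vⱼ))) ⟨
      ∑ (λ i → ⟦ S ⊆? V i ⟧) ∎
    outsideU S⊈U (no S⊈V) = begin
      ⟦ independent? G S ⟧    ≡⟨ ⟦⟧-no (independent? G S) (λ ind → S⊈V (independent-⊈U ind S⊈U)) ⟩
      0                       ≡⟨ sum-replicate-zero 3 ⟨
      ∑ {3} (λ _ → 0)         ≡⟨ sum-cong-≗ (λ i → ⟦⟧-no (S ⊆? V i) (λ S⊆Vᵢ → S⊈V (i , S⊆Vᵢ))) ⟨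
      ∑ (λ i → ⟦ S ⊆? V i ⟧) ∎
    by-cases : Dec (S ⊆ U) →
      ⟦ independent? G S ⟧ + ∑ (λ i → ⟦ S ⊆? W i ⟧) ≡ ⟦ S ⊆? U ⟧ + ∑ (λ i → ⟦ S ⊆? V i ⟧)
    by-cases (yes S⊆U) = cong₂ _+_
      (trans (⟦⟧-yes (independent? G S)
                (independent-⊆ singleton? singleton⇒proper singleton∪singleton≢⊤ S⊆U))
             (sym (⟦⟧-yes (S ⊆? U) S⊆U)))
      (sum-cong-≗ (λ i → ⟦⟧-cong (S ⊆? W i) (S ⊆? V i)
        (λ S⊆W → ⊆W⇒⊆V i S⊆W) (λ S⊆V → ⊆V∧⊆U⇒⊆W i S⊆V S⊆U)))
    by-cases (no S⊈U) = begin
      ⟦ independent? G S ⟧ + ∑ (λ i → ⟦ S ⊆? W i ⟧)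
        ≡⟨ cong₂ _+_ (outsideU S⊈U (any? (λ i → S ⊆? V i)))
             (trans (sum-cong-≗ (λ i → ⟦⟧-no (S ⊆? W i) (λ S⊆W → S⊈U (⊆W⇒⊆U i S⊆W))))
                    (sum-replicate-zero 3)) ⟩
      ∑ (λ i → ⟦ S ⊆? V i ⟧) + 0
        ≡⟨ +-comm _ 0 ⟩
      0 + ∑ (λ i → ⟦ S ⊆? V i ⟧)
        ≡⟨ cong (_+ ∑ (λ i → ⟦ S ⊆? V i ⟧)) (⟦⟧-no (S ⊆? U) S⊈U) ⟨
      ⟦ S ⊆? U ⟧ + ∑ (λ i → ⟦ S ⊆? V i ⟧) ∎

  s-identity : ∀ k →
    s k G + ∑ (λ i → ∣ W i ∣ C k) ≡ ∣ U ∣ C k + ∑ (λ i → ∣ V i ∣ C k)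
  s-identity k = begin
    s k G + ∑ (λ i → ∣ W i ∣ C k)
      ≡⟨ cong₂ _+_ (length-filter₂ (λ S → ∣ S ∣ ≟ k) (independent? G) (subsets n)) (∑∣∣C W) ⟩
    ∑ₛ (λ S → ⟦ sized? S (independent? G S) ⟧) + ∑ₛ (λ S → ∑ (λ i → ⟦ sized? S (S ⊆? W i) ⟧))
      ≡⟨ ∑ₗ-+ (subsets n) _ _ ⟨
    ∑ₛ (λ S → ⟦ sized? S (independent? G S) ⟧ + ∑ (λ i → ⟦ sized? S (S ⊆? W i) ⟧))
      ≡⟨ ∑ₗ-cong (subsets n) (λ S → restrict S (does (∣ S ∣ ≟ k))) ⟩
    ∑ₛ (λ S → ⟦ sized? S (S ⊆? U) ⟧ + ∑ (λ i → ⟦ sized? S (S ⊆? V i) ⟧))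
      ≡⟨ ∑ₗ-+ (subsets n) _ _ ⟩
    ∑ₛ (λ S → ⟦ sized? S (S ⊆? U) ⟧) + ∑ₛ (λ S → ∑ (λ i → ⟦ sized? S (S ⊆? V i) ⟧))
      ≡⟨ cong₂ _+_ (∑ₛ-⊆ U k) (sym (∑∣∣C V)) ⟩
    ∣ U ∣ C k + ∑ (λ i → ∣ V i ∣ C k) ∎
    where
    open ≡-Reasoning
    sized? : ∀ S {A : Set} → Dec A → Dec (∣ S ∣ ≡ k × A)
    sized? S a? = (∣ S ∣ ≟ k) ×-dec a?
    bracket : Bool → ℕ
    bracket b = if b then 1 else 0
    -- Here `b` stands for the test |S| = k: if it fails, both sides vanish.
    restrict : ∀ S b →
      bracket (b ∧ does (independent? G S)) + ∑ (λ i → bracket (b ∧ does (S ⊆? W i))) ≡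
      bracket (b ∧ does (S ⊆? U)) + ∑ (λ i → bracket (b ∧ does (S ⊆? V i)))
    restrict S true  = indicator-identity S
    restrict S false = refl
    ∑∣∣C : (T : Fin 3 → Subset n) →
      ∑ (λ i → ∣ T i ∣ C k) ≡ ∑ₛ (λ S → ∑ (λ i → ⟦ sized? S (S ⊆? T i) ⟧))
    ∑∣∣C T = trans (sum-cong-≗ (λ i → sym (∑ₛ-⊆ (T i) k)))
      (sym (∑ₗ-∑-comm (subsets n) (λ i S → ⟦ sized? S (S ⊆? T i) ⟧)))

  -- The sizes enter through equations, so that any closed forms proved for them can stand in the
  -- exponents.
  I-≈ₚ : ∀ {u v₀ v₁ v₂ w₀ w₁ w₂} → ∣ U ∣ ≡ u →
    ∣ V zero ∣ ≡ v₀ → ∣ V (suc zero) ∣ ≡ v₁ → ∣ V (suc (suc zero)) ∣ ≡ v₂ →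
    ∣ W zero ∣ ≡ w₀ → ∣ W (suc zero) ∣ ≡ w₁ → ∣ W (suc (suc zero)) ∣ ≡ w₂ →
    I G ≈ₚ (1ₚ +ₚ X) ^ₚ u +[1+X]^ v₀ -[1+X]^ w₀ +[1+X]^ v₁ -[1+X]^ w₁ +[1+X]^ v₂ -[1+X]^ w₂
  I-≈ₚ {u} {v₀} {v₁} {v₂} {w₀} {w₁} {w₂} refl refl refl refl refl refl refl k = begin
    coeff (I G) k
      ≡⟨ coeff-I G k ⟩
    pos (s k G)
      ≡⟨ isolate (s k G) (w₀ C k) (w₁ C k) (w₂ C k) (u C k) (v₀ C k) (v₁ C k) (v₂ C k)
           (s-identity k) ⟩
    pos (u C k) ℤ.+ pos (v₀ C k) ℤ.- pos (w₀ C k) ℤ.+ pos (v₁ C k) ℤ.- pos (w₁ C k)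
      ℤ.+ pos (v₂ C k) ℤ.- pos (w₂ C k)
      ≡⟨ cong (λ c → c ℤ.+ pos (v₀ C k) ℤ.- pos (w₀ C k) ℤ.+ pos (v₁ C k) ℤ.- pos (w₁ C k)
                       ℤ.+ pos (v₂ C k) ℤ.- pos (w₂ C k)) (coeff-[1+X]^ u k) ⟨
    coeff f₀ k ℤ.+ pos (v₀ C k) ℤ.- pos (w₀ C k) ℤ.+ pos (v₁ C k) ℤ.- pos (w₁ C k)
      ℤ.+ pos (v₂ C k) ℤ.- pos (w₂ C k)
      ≡⟨ cong (λ c → c ℤ.+ pos (v₁ C k) ℤ.- pos (w₁ C k) ℤ.+ pos (v₂ C k) ℤ.- pos (w₂ C k))
           (coeff-+[1+X]^-[1+X]^ f₀ v₀ w₀ k) ⟨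
    coeff f₁ k ℤ.+ pos (v₁ C k) ℤ.- pos (w₁ C k) ℤ.+ pos (v₂ C k) ℤ.- pos (w₂ C k)
      ≡⟨ cong (λ c → c ℤ.+ pos (v₂ C k) ℤ.- pos (w₂ C k)) (coeff-+[1+X]^-[1+X]^ f₁ v₁ w₁ k) ⟨
    coeff f₂ k ℤ.+ pos (v₂ C k) ℤ.- pos (w₂ C k)
      ≡⟨ coeff-+[1+X]^-[1+X]^ f₂ v₂ w₂ k ⟨
    coeff (f₂ +[1+X]^ v₂ -[1+X]^ w₂) k ∎
    where
    open ≡-Reasoning
    f₀ = (1ₚ +ₚ X) ^ₚ u
    f₁ = f₀ +[1+X]^ v₀ -[1+X]^ w₀
    f₂ = f₁ +[1+X]^ v₁ -[1+X]^ w₁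

-- Products of selected primes, and divisibility by them.

∏ : ∀ {m} → Vec ℕ m → Subset m → ℕ
∏ []       []            = 1
∏ (p ∷ ps) (inside ∷ t)  = p * ∏ ps t
∏ (p ∷ ps) (outside ∷ t) = ∏ ps t

∏-complement : ∀ {m} (ps : Vec ℕ m) t → ∏ ps t * ∏ ps (∁ t) ≡ ∏ ps ⊤
∏-complement []       []            = refl
∏-complement (p ∷ ps) (inside ∷ t)  =
  trans (*-assoc p (∏ ps t) (∏ ps (∁ t))) (cong (p *_) (∏-complement ps t))
∏-complement (p ∷ ps) (outside ∷ t) =
  trans (x∙yz≈y∙xz (∏ ps t) p (∏ ps (∁ t))) (cong (p *_) (∏-complement ps t))
  where open import Algebra.Properties.CommutativeSemigroup *-commutativeSemigroup

∏>0 : ∀ {m} {ps : Vec ℕ m} → All Prime ps → ∀ t → 0 < ∏ ps t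
∏>0 []       []            = s≤s z≤n
∏>0 (p ∷ ps) (inside ∷ t)  = *-mono-< (>-nonZero⁻¹ _ {{prime⇒nonZero p}}) (∏>0 ps t)
∏>0 (p ∷ ps) (outside ∷ t) = ∏>0 ps t

∏>1 : ∀ {m} {ps : Vec ℕ m} → All Prime ps → ∀ {t} → Nonempty t → 1 < ∏ ps t
∏>1 (p ∷ ps) {inside ∷ t}  _ =
  *-mono-≤ (nonTrivial⇒n>1 _ {{prime⇒nonTrivial p}}) (∏>0 ps t)
∏>1 (p ∷ ps) {outside ∷ t} (suc i , there i∈t) = ∏>1 ps (i , i∈t)

-- A common divisor of k and mn divides k, so it is coprime to m; it therefore divides n as well,
-- and must be 1.
coprime-* : ∀ {k m n} → Coprime k m → Coprime k n → Coprime k (m * n)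
coprime-* km kn (d∣k , d∣mn) =
  kn (d∣k , coprime-divisor (λ (e∣d , e∣m) → km (∣-trans e∣d d∣k , e∣m)) d∣mn)

coprime-∏ : ∀ {m k} {ps : Vec ℕ m} → All (Coprime k) ps → ∀ t → Coprime k (∏ ps t)
coprime-∏ []       []            (_ , d∣1) = ∣1⇒≡1 d∣1
coprime-∏ (c ∷ cs) (inside ∷ t)  = coprime-* c (coprime-∏ cs t)
coprime-∏ (c ∷ cs) (outside ∷ t) = coprime-∏ cs t

divisors : ∀ {m} → Vec ℕ m → ℕ → Subset m
divisors ps a = Vec.map (λ p → does (p ∣? a)) ps

-- Euclid's lemma at each prime. This is what turns a product of residues into a union of sets.
divisors-* : ∀ {m} {ps : Vec ℕ m} → All Prime ps → ∀ a b →
  divisors ps (a * b) ≡ divisors ps a ∪ divisors ps b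
divisors-* []                  a b = refl
divisors-* {ps = p ∷ _} (pPrime ∷ primes) a b = cong₂ _∷_
  (does-⇔ (mk⇔ (euclidsLemma a b pPrime) [ ∣m⇒∣m*n b , ∣n⇒∣m*n a ]′)
    (p ∣? (a * b)) ((p ∣? a) ⊎-dec (p ∣? b)))
  (divisors-* primes a b)

-- Write a as q times the product over the tail. The prime p divides a and is coprime to that
-- product, so it divides q.
⊆divisors⇒∏∣ : ∀ {m} {ps : Vec ℕ m} → AllPairs Coprime ps → ∀ t {a} →
  t ⊆ divisors ps a → ∏ ps t ∣ a
⊆divisors⇒∏∣ {ps = []}     []       []            _  = 1∣ _
⊆divisors⇒∏∣ {ps = p ∷ ps} (c ∷ cs) (inside ∷ t)  {a} t⊆ with p ∣? a
... | no _    with () ← t⊆ here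
... | yes p∣a with divides q a≡q∏ ← ⊆divisors⇒∏∣ cs t (drop-∷-⊆ t⊆) =
  subst (p * ∏ ps t ∣_) (sym a≡q∏)
    (*-monoˡ-∣ (∏ ps t) (coprime-divisor (coprime-∏ c t)
      (subst (p ∣_) (trans a≡q∏ (*-comm q _)) p∣a)))
⊆divisors⇒∏∣ {ps = p ∷ ps} (c ∷ cs) (outside ∷ t) t⊆ = ⊆divisors⇒∏∣ cs t (drop-∷-⊆ t⊆)

∏∣⇒⊆divisors : ∀ {m} (ps : Vec ℕ m) t {a} → ∏ ps t ∣ a → t ⊆ divisors ps a
∏∣⇒⊆divisors (p ∷ ps) (inside ∷ t) {a} p∏∣a here
  rewrite dec-true (p ∣? a) (∣-trans (m∣m*n (∏ ps t)) p∏∣a) = here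
∏∣⇒⊆divisors (p ∷ ps) (inside ∷ t) p∏∣a (there i∈t) =
  there (∏∣⇒⊆divisors ps t (∣-trans (n∣m*n p) p∏∣a) i∈t)
∏∣⇒⊆divisors (p ∷ ps) (outside ∷ t) ∏∣a (there i∈t) = there (∏∣⇒⊆divisors ps t ∏∣a i∈t)

-- Counting multiples.

∑-split : ∀ d n (f : ℕ → ℕ) →
  ∑ {d + n} (f ∘ toℕ) ≡ ∑ {d} (f ∘ toℕ) + ∑ {n} (λ a → f (d + toℕ a))
∑-split zero    n f = refl
∑-split (suc d) n f = trans (cong (f 0 +_) (∑-split d n (f ∘ suc))) (sym (+-assoc (f 0) _ _))

-- Cut the range into k blocks of length d. The first contains only the multiple 0, and shifting by
-- d preserves divisibility by d.
count-multiples : ∀ d .{{_ : NonZero d}} k → ∑ {k * d} (λ a → ⟦ d ∣? toℕ a ⟧) ≡ k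
count-multiples d         zero    = refl
count-multiples d@(suc _) (suc k) = begin
  ∑ {d + k * d} (λ a → ⟦ d ∣? toℕ a ⟧)
    ≡⟨ ∑-split d (k * d) (λ a → ⟦ d ∣? a ⟧) ⟩
  ∑ {d} (λ a → ⟦ d ∣? toℕ a ⟧) + ∑ {k * d} (λ a → ⟦ d ∣? (d + toℕ a) ⟧)
    ≡⟨ cong₂ _+_
         (trans (∑-only {d} (λ a → ⟦ d ∣? toℕ a ⟧) zero no-multiple) (⟦⟧-yes (d ∣? 0) (d ∣0)))
         (sum-cong-≗ {k * d} (λ a → ⟦⟧-cong (d ∣? (d + toℕ a)) (d ∣? toℕ a)
           (λ d∣d+a → ∣m+n∣m⇒∣n d∣d+a ∣-refl) (∣m∣n⇒∣m+n ∣-refl))) ⟩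
  1 + ∑ {k * d} (λ a → ⟦ d ∣? toℕ a ⟧)
    ≡⟨ cong suc (count-multiples d k) ⟩
  suc k ∎
  where
  open ≡-Reasoning
  no-multiple : ∀ (a : Fin d) → a ≢ zero → ⟦ d ∣? toℕ a ⟧ ≡ 0
  no-multiple zero    a≢0 = ⊥-elim (a≢0 refl)
  no-multiple (suc a) _   = ⟦⟧-no (d ∣? suc (toℕ a)) (>⇒∤ (s≤s (toℕ<n a)))

-- The zero divisor graph in terms of the primes dividing a residue.

module _ {m : ℕ} {ps : Vec ℕ m} (primes : All Prime ps) (coprimes : AllPairs Coprime ps)
  {n : ℕ} .{{_ : NonZero n}} (n≡∏ : n ≡ ∏ ps ⊤) where

  open ℤ-mod n

  σ : Fin n → Subset m
  σ a = divisors ps (toℕ a)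

  -- t ⊆ σ a means that `∏ ps t` divides a, and n is `∏ ps t` times the product over the complement.
  ∑-⊆σ : ∀ t → ∑ (λ a → ⟦ t ⊆? σ a ⟧) ≡ ∏ ps (∁ t)
  ∑-⊆σ t = begin
    ∑ {n} (λ a → ⟦ t ⊆? divisors ps (toℕ a) ⟧)
      ≡⟨ sum-cong-≗ {n} (λ a → ⟦⟧-cong (t ⊆? σ a) (∏ ps t ∣? toℕ a)
           (λ t⊆ → ⊆divisors⇒∏∣ coprimes t t⊆) (λ ∏∣ → ∏∣⇒⊆divisors ps t ∏∣)) ⟩
    ∑ {n} (λ a → ⟦ ∏ ps t ∣? toℕ a ⟧)
      -- The summand sees a only through `toℕ`, so the length of the range can be replaced by an
      -- equal number.
      ≡⟨ cong (λ n → ∑ {n} (λ a → ⟦ ∏ ps t ∣? toℕ a ⟧))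
           (trans n≡∏ (trans (sym (∏-complement ps t)) (*-comm (∏ ps t) _))) ⟩
    ∑ {∏ ps (∁ t) * ∏ ps t} (λ a → ⟦ ∏ ps t ∣? toℕ a ⟧)
      ≡⟨ count-multiples (∏ ps t) {{>-nonZero (∏>0 primes t)}} (∏ ps (∁ t)) ⟩
    ∏ ps (∁ t) ∎
    where open ≡-Reasoning

  n∣⇒divisors≡⊤ : ∀ {a} → n ∣ a → divisors ps a ≡ ⊤
  n∣⇒divisors≡⊤ n∣a = ⊆-antisym ⊆⊤ (∏∣⇒⊆divisors ps ⊤ (subst (_∣ _) n≡∏ n∣a))

  divisors≡⊤⇒n∣ : ∀ {a} → divisors ps a ≡ ⊤ → n ∣ a
  divisors≡⊤⇒n∣ eq = subst (_∣ _) (sym n≡∏)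
    (⊆divisors⇒∏∣ coprimes ⊤ (λ {x} _ → subst (x ∈_) (sym eq) ∈⊤))

  mod≡0⇒∣ : ∀ {a} → a mod n ≡ 0ₙ → n ∣ a
  mod≡0⇒∣ {a} eq = m%n≡0⇒n∣m a n
    (trans (sym (toℕ-fromℕ< _)) (trans (cong toℕ eq) (trans (toℕ-fromℕ< _) (n∣m⇒m%n≡0 0 n (n ∣0)))))

  ∣⇒mod≡0 : ∀ {a} → n ∣ a → a mod n ≡ 0ₙ
  ∣⇒mod≡0 {a} n∣a = toℕ-injective (trans (toℕ-fromℕ< _)
    (trans (trans (n∣m⇒m%n≡0 a n n∣a) (sym (n∣m⇒m%n≡0 0 n (n ∣0)))) (sym (toℕ-fromℕ< _))))

  toℕ-0ₙ : toℕ 0ₙ ≡ 0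
  toℕ-0ₙ = trans (toℕ-fromℕ< _) (n∣m⇒m%n≡0 0 n (n ∣0))

  ≡0⇒σ≡⊤ : ∀ {a} → a ≡ 0ₙ → σ a ≡ ⊤
  ≡0⇒σ≡⊤ refl = n∣⇒divisors≡⊤ (subst (n ∣_) (sym toℕ-0ₙ) (n ∣0))

  σ≡⊤⇒≡0 : ∀ {a} → σ a ≡ ⊤ → a ≡ 0ₙ
  σ≡⊤⇒≡0 {a} eq = toℕ-injective (trans (n∣a<n⇒≡0 (divisors≡⊤⇒n∣ eq) (toℕ<n a)) (sym toℕ-0ₙ))
    where
    n∣a<n⇒≡0 : ∀ {a} → n ∣ a → a < n → a ≡ 0
    n∣a<n⇒≡0 {zero}  _   _   = refl
    n∣a<n⇒≡0 {suc a} n∣a a<n = ⊥-elim (>⇒∤ a<n n∣a)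

  *≡0⇔σ∪σ≡⊤ : ∀ {a b} → a *ₙ b ≡ 0ₙ ⇔ σ a ∪ σ b ≡ ⊤
  *≡0⇔σ∪σ≡⊤ {a} {b} = mk⇔
    (λ ab≡0 → trans (sym (divisors-* primes (toℕ a) (toℕ b))) (n∣⇒divisors≡⊤ (mod≡0⇒∣ ab≡0)))
    (λ eq → ∣⇒mod≡0 (divisors≡⊤⇒n∣ (trans (divisors-* primes (toℕ a) (toℕ b)) eq)))

  -- If no prime divided a, then ab = 0 would make every prime divide b, hence b = 0. Conversely,
  -- the product of the primes not dividing a annihilates a.
  vertex⇔proper : ∀ {a} → Vertex (Γℤ n) a ⇔ Proper (σ a)
  vertex⇔proper {a} = mk⇔ to from
    where
    to : Vertex (Γℤ n) a → Proper (σ a)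
    to (a≢0 , b , b≢0 , ab≡0) = nonempty , (a≢0 ∘ σ≡⊤⇒≡0)
      where
      nonempty : Nonempty (σ a)
      nonempty with nonempty? (σ a)
      ... | yes ne = ne
      ... | no ¬ne = ⊥-elim (b≢0 (σ≡⊤⇒≡0 (trans (sym (∪-identityˡ (σ b)))
              (trans (cong (_∪ σ b) (sym (Empty-unique ¬ne))) (Equivalence.to *≡0⇔σ∪σ≡⊤ ab≡0)))))
    from : Proper (σ a) → Vertex (Γℤ n) a
    from (nonempty , σa≢⊤) = (σa≢⊤ ∘ ≡0⇒σ≡⊤) , b , b≢0 , ∣⇒mod≡0 n∣ab
      where
      -- The annihilator of a. It is below n because at least one prime divides a, and n divides ac
      -- because `∏ ps (σ a)` divides a.
      c = ∏ ps (∁ (σ a))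
      n≡∏c : n ≡ ∏ ps (σ a) * c
      n≡∏c = trans n≡∏ (sym (∏-complement ps (σ a)))
      c>0 : 0 < c
      c>0 = ∏>0 primes (∁ (σ a))
      c<n : c < n
      c<n = subst (c <_) (sym n≡∏c)
        (subst (_< ∏ ps (σ a) * c) (*-identityˡ c)
          (*-monoˡ-< c {{>-nonZero c>0}} (∏>1 primes nonempty)))
      b : Fin n
      b = fromℕ< c<n
      b≢0 : b ≢ 0ₙ
      b≢0 b≡0 = <⇒≢ c>0 (trans (sym toℕ-0ₙ) (trans (cong toℕ (sym b≡0)) (toℕ-fromℕ< c<n)))
      n∣ab : n ∣ toℕ a * toℕ b
      n∣ab = subst₂ _∣_ (sym n≡∏c) (cong (toℕ a *_) (sym (toℕ-fromℕ< c<n)))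
        (*-monoˡ-∣ c (⊆divisors⇒∏∣ coprimes (σ a) (λ i∈ → i∈)))

  adj⇔∪≡⊤ : ∀ {a b} → Adj (Γℤ n) a b ⇔ (a ≢ b × σ a ∪ σ b ≡ ⊤)
  adj⇔∪≡⊤ = mk⇔
    (λ (a≢b , ab≡0) → a≢b , Equivalence.to *≡0⇔σ∪σ≡⊤ ab≡0)
    (λ (a≢b , eq) → a≢b , Equivalence.from *≡0⇔σ∪σ≡⊤ eq)

-- Class sizes from the numbers of residues divisible by given primes.

-- Inclusion–exclusion, with both sides moved so that no subtraction occurs.
nonemptyWithout-count : (i : Fin 3) (t : Subset 3) →
  ⟦ nonemptyWithout? i t ⟧ + (∑ (λ j → ⟦ ∁ ⁅ j ⁆ ⊆? t ⟧) + ⟦ ⁅ i ⁆ ⊆? t ⟧)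
    ≡ ∑ (λ j → ⟦ ⁅ j ⁆ ⊆? t ⟧) + ⟦ ⊤ ⊆? t ⟧
nonemptyWithout-count = from-yes (all? (λ (i : Fin 3) → allSubsets? (λ (t : Subset 3) →
  ⟦ nonemptyWithout? i t ⟧ + (∑ (λ j → ⟦ ∁ ⁅ j ⁆ ⊆? t ⟧) + ⟦ ⁅ i ⁆ ⊆? t ⟧)
    ≟ ∑ (λ j → ⟦ ⁅ j ⁆ ⊆? t ⟧) + ⟦ ⊤ ⊆? t ⟧)))

-- A nonempty set missing `i` is a singleton or `∁ ⁅ i ⁆`. The only other set containing `∁ ⁅ i ⁆`
-- is `⊤`, balanced on the right.
nonemptyWithout-split : (i : Fin 3) (t : Subset 3) →
  ⟦ singletonWithout? i t ⟧ + ⟦ ∁ ⁅ i ⁆ ⊆? t ⟧ ≡ ⟦ nonemptyWithout? i t ⟧ + ⟦ ⊤ ⊆? t ⟧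
nonemptyWithout-split = from-yes (all? (λ (i : Fin 3) → allSubsets? (λ (t : Subset 3) →
  ⟦ singletonWithout? i t ⟧ + ⟦ ∁ ⁅ i ⁆ ⊆? t ⟧ ≟ ⟦ nonemptyWithout? i t ⟧ + ⟦ ⊤ ⊆? t ⟧)))

-- The formula S₁ - 2 S₂ + 3 S₃ for exactly one of three properties; the pairs are indexed by their
-- complements `⁅ j ⁆`.
singleton-count : (t : Subset 3) →
  ⟦ singleton? t ⟧ + (∑ (λ j → ⟦ ∁ ⁅ j ⁆ ⊆? t ⟧) + ∑ (λ j → ⟦ ∁ ⁅ j ⁆ ⊆? t ⟧))
    ≡ ∑ (λ j → ⟦ ⁅ j ⁆ ⊆? t ⟧) + (⟦ ⊤ ⊆? t ⟧ + (⟦ ⊤ ⊆? t ⟧ + ⟦ ⊤ ⊆? t ⟧))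
singleton-count = from-yes (allSubsets? (λ (t : Subset 3) →
  ⟦ singleton? t ⟧ + (∑ (λ j → ⟦ ∁ ⁅ j ⁆ ⊆? t ⟧) + ∑ (λ j → ⟦ ∁ ⁅ j ⁆ ⊆? t ⟧))
    ≟ ∑ (λ j → ⟦ ⁅ j ⁆ ⊆? t ⟧) + (⟦ ⊤ ⊆? t ⟧ + (⟦ ⊤ ⊆? t ⟧ + ⟦ ⊤ ⊆? t ⟧))))

-- `M t` counts the a with t ⊆ σ a, so summing the pointwise identities over a expresses the class
-- sizes through `M`.
module _ {n : ℕ} (σ : Fin n → Subset 3) (M : Subset 3 → ℕ)
  (∑-⊆ : ∀ t → ∑ (λ a → ⟦ t ⊆? σ a ⟧) ≡ M t) where

  ∑≡∣preimage∣ : {P : Pred (Subset 3) 0ℓ} (P? : Decidable P) →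
    ∑ (λ a → ⟦ P? (σ a) ⟧) ≡ ∣ preimage σ P? ∣
  ∑≡∣preimage∣ P? = sym (∣preimage∣ σ P?)

  ∑-+ : ∀ {f g : Fin n → ℕ} {x y} → ∑ f ≡ x → ∑ g ≡ y → ∑ (λ a → f a + g a) ≡ x + y
  ∑-+ {f} {g} ∑f≡x ∑g≡y = trans (∑-distrib-+ f g) (cong₂ _+_ ∑f≡x ∑g≡y)

  ∑-∑-⊆ : (T : Fin 3 → Subset 3) →
    ∑ (λ a → ∑ (λ j → ⟦ T j ⊆? σ a ⟧)) ≡ ∑ (λ j → M (T j))
  ∑-∑-⊆ T = trans (∑-comm (λ a j → ⟦ T j ⊆? σ a ⟧)) (sum-cong-≗ (λ j → ∑-⊆ (T j)))

  ∣nonemptyWithout∣ : ∀ i →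
    ∣ preimage σ (nonemptyWithout? i) ∣ + (∑ (λ j → M (∁ ⁅ j ⁆)) + M ⁅ i ⁆)
      ≡ ∑ (λ j → M ⁅ j ⁆) + M ⊤
  ∣nonemptyWithout∣ i = trans
    (sym (∑-+ (∑≡∣preimage∣ (nonemptyWithout? i)) (∑-+ (∑-∑-⊆ (∁ ∘ ⁅_⁆)) (∑-⊆ ⁅ i ⁆))))
    (trans (sum-cong-≗ (nonemptyWithout-count i ∘ σ)) (∑-+ (∑-∑-⊆ ⁅_⁆) (∑-⊆ ⊤)))

  ∣singletonWithout∣ : ∀ i →
    ∣ preimage σ (singletonWithout? i) ∣ + M (∁ ⁅ i ⁆) ≡ ∣ preimage σ (nonemptyWithout? i) ∣ + M ⊤
  ∣singletonWithout∣ i = trans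
    (sym (∑-+ (∑≡∣preimage∣ (singletonWithout? i)) (∑-⊆ (∁ ⁅ i ⁆))))
    (trans (sum-cong-≗ (nonemptyWithout-split i ∘ σ))
           (∑-+ (∑≡∣preimage∣ (nonemptyWithout? i)) (∑-⊆ ⊤)))

  ∣singleton∣ :
    ∣ preimage σ singleton? ∣ + (∑ (λ j → M (∁ ⁅ j ⁆)) + ∑ (λ j → M (∁ ⁅ j ⁆)))
      ≡ ∑ (λ j → M ⁅ j ⁆) + (M ⊤ + (M ⊤ + M ⊤))
  ∣singleton∣ = trans
    (sym (∑-+ (∑≡∣preimage∣ singleton?) (∑-+ (∑-∑-⊆ (∁ ∘ ⁅_⁆)) (∑-∑-⊆ (∁ ∘ ⁅_⁆)))))
    (trans (sum-cong-≗ (singleton-count ∘ σ)) (∑-+ (∑-∑-⊆ ⁅_⁆) (∑-+ (∑-⊆ ⊤) (∑-+ (∑-⊆ ⊤) (∑-⊆ ⊤)))))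

-- Closed forms of the class sizes.

-- With the arguments written as successors the truncated subtractions compute, and a common summand
-- cancels.
nonemptyWithout-size : ∀ p q r {v} → 0 < p → 0 < q → 0 < r →
  v + (p + q + r + q * r) ≡ q * r + p * r + p * q + 1 → v ≡ (p ∸ 1) * (q + r ∸ 1)
nonemptyWithout-size (suc p) (suc q) (suc r) {v} _ _ _ eq =
  +-cancelʳ-≡ (suc p + suc q + suc r + suc q * suc r) _ _ (trans eq (identity p q r))
  where
  identity : ∀ p q r →
    suc q * suc r + suc p * suc r + suc p * suc q + 1 ≡
    p * (q + suc r) + (suc p + suc q + suc r + suc q * suc r)
  identity = ℕ-Solver.solve-∀

singletonWithout-size : ∀ p q r {v w} → 0 < p → 0 < q → 0 < r →
  w + p ≡ v + 1 → v ≡ (p ∸ 1) * (q + r ∸ 1) → w ≡ (p ∸ 1) * (q + r ∸ 2)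
singletonWithout-size (suc p) (suc q) (suc r) {v} {w} _ _ _ eq refl
  -- Exposes the second successor that `∸ 2` removes.
  rewrite +-suc q r = +-cancelʳ-≡ (suc p) _ _ (trans eq (identity p (q + r)))
  where
  identity : ∀ p m → p * suc m + 1 ≡ p * m + suc p
  identity = ℕ-Solver.solve-∀

-- The 3 is added after a truncated difference, so 2(p + q + r) ≤ pq + qr + pr is required; it is
-- the sum of 2q ≤ pq, 2r ≤ qr and 2p ≤ pr.
singleton-size : ∀ p q r {u} → 2 ≤ p → 2 ≤ q → 2 ≤ r →
  u + 2 * (p + q + r) ≡ p * q + q * r + p * r + 3 → u ≡ p * q + q * r + p * r ∸ 2 * (p + q + r) + 3
singleton-size p q r {u} 2≤p 2≤q 2≤r eq = begin
  u                       ≡⟨ m+n∸n≡m u m ⟨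
  u + m ∸ m               ≡⟨ cong (_∸ m) eq ⟩
  T + 3 ∸ m               ≡⟨ +-∸-comm 3 m≤T ⟩
  T ∸ m + 3               ∎
  where
  open ≡-Reasoning
  m = 2 * (p + q + r)
  T = p * q + q * r + p * r
  distribute : ∀ p q r → 2 * q + 2 * r + 2 * p ≡ 2 * (p + q + r)
  distribute = ℕ-Solver.solve-∀
  m≤T : m ≤ T
  m≤T = subst (_≤ T) (distribute p q r)
    (+-mono-≤ (+-mono-≤ (*-monoˡ-≤ q 2≤p) (*-monoˡ-≤ r 2≤q))
              (subst (_≤ p * r) (*-comm p 2) (*-monoʳ-≤ p 2≤r)))

theorem4p1 : (p q r : ℕ) (pPrime : Prime p) (qPrime : Prime q) (rPrime : Prime r) →
    p < q → q < r →
    I (Γℤ (p * q * r) {{pqr≢0 pPrime qPrime rPrime}})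
    ≈ₚ
    (1ₚ +ₚ X) ^ₚ (p * q + q * r + p * r ∸ 2 * (p + q + r) + 3)
    +ₚ (1ₚ +ₚ X) ^ₚ ((p ∸ 1) * (q + r ∸ 1))
    -ₚ (1ₚ +ₚ X) ^ₚ ((p ∸ 1) * (q + r ∸ 2))
    +ₚ (1ₚ +ₚ X) ^ₚ ((q ∸ 1) * (p + r ∸ 1))
    -ₚ (1ₚ +ₚ X) ^ₚ ((q ∸ 1) * (p + r ∸ 2))
    +ₚ (1ₚ +ₚ X) ^ₚ ((r ∸ 1) * (p + q ∸ 1))
    -ₚ (1ₚ +ₚ X) ^ₚ ((r ∸ 1) * (p + q ∸ 2))
theorem4p1 p q r pPrime qPrime rPrime p<q q<r =
  I-≈ₚ (Γℤ (p * q * r)) τ (vertex⇔proper primes coprimes n≡∏) (adj⇔∪≡⊤ primes coprimes n≡∏)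
    u-size v₀-size v₁-size v₂-size w₀-size w₁-size w₂-size
  where
  instance
    _ = pqr≢0 pPrime qPrime rPrime
  ps = p ∷ q ∷ r ∷ []
  primes : All Prime ps
  primes = pPrime ∷ qPrime ∷ rPrime ∷ []
  distinct⇒coprime : ∀ {p q} → Prime p → Prime q → p < q → Coprime p q
  distinct⇒coprime pPrime qPrime p<q =
    coprime-sym (prime⇒coprime qPrime {{prime⇒nonZero pPrime}} p<q)
  coprimes : AllPairs Coprime ps
  coprimes = (distinct⇒coprime pPrime qPrime p<q ∷ distinct⇒coprime pPrime rPrime (<-trans p<q q<r) ∷ [])
           ∷ (distinct⇒coprime qPrime rPrime q<r ∷ []) ∷ [] ∷ []
  n≡∏ : p * q * r ≡ ∏ ps ⊤
  n≡∏ = trans (*-assoc p q r) (cong (λ x → p * (q * x)) (sym (*-identityʳ r)))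
  τ : Fin (p * q * r) → Subset 3
  τ = σ primes coprimes n≡∏
  -- The residues divisible by every prime in `t` are as many as the product of the other primes.
  M : Subset 3 → ℕ
  M t = ∏ ps (∁ t)
  ∑-⊆ = ∑-⊆σ primes coprimes n≡∏
  u = ∣ preimage τ singleton? ∣
  v w : Fin 3 → ℕ
  v i = ∣ preimage τ (nonemptyWithout? i) ∣
  w i = ∣ preimage τ (singletonWithout? i) ∣
  2≤ : ∀ {p} → Prime p → 2 ≤ p
  2≤ pPrime = nonTrivial⇒n>1 _ {{prime⇒nonTrivial pPrime}}
  0< : ∀ {p} → Prime p → 0 < p
  0< pPrime = <-trans (s≤s z≤n) (2≤ pPrime)
  v≡ : ∀ i → v i + (∑ (λ j → M (∁ ⁅ j ⁆)) + M ⁅ i ⁆) ≡ ∑ (λ j → M ⁅ j ⁆) + M ⊤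
  v≡ = ∣nonemptyWithout∣ τ M ∑-⊆
  w≡ : ∀ i → w i + M (∁ ⁅ i ⁆) ≡ v i + M ⊤
  w≡ = ∣singletonWithout∣ τ M ∑-⊆
  u-size : u ≡ p * q + q * r + p * r ∸ 2 * (p + q + r) + 3
  u-size = singleton-size p q r (2≤ pPrime) (2≤ qPrime) (2≤ rPrime)
    (trans (lhs u p q r) (trans (∣singleton∣ τ M ∑-⊆) (rhs p q r)))
    where
    -- The factors 1 and summands 0 are left over from unfolding `∏` and `∑`; the 3 on the right is
    -- three times `M ⊤` = 1.
    lhs : ∀ u p q r → u + 2 * (p + q + r) ≡
      u + (p * 1 + (q * 1 + (r * 1 + 0)) + (p * 1 + (q * 1 + (r * 1 + 0))))
    lhs = ℕ-Solver.solve-∀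
    rhs : ∀ p q r → q * (r * 1) + (p * (r * 1) + (p * (q * 1) + 0)) + 3 ≡
      p * q + q * r + p * r + 3
    rhs = ℕ-Solver.solve-∀
  v₀-size : v zero ≡ (p ∸ 1) * (q + r ∸ 1)
  v₀-size = nonemptyWithout-size p q r (0< pPrime) (0< qPrime) (0< rPrime)
    (trans (lhs (v zero) p q r) (trans (v≡ zero) (rhs p q r)))
    where
    lhs : ∀ v p q r → v + (p + q + r + q * r) ≡
      v + (p * 1 + (q * 1 + (r * 1 + 0)) + q * (r * 1))
    lhs = ℕ-Solver.solve-∀
    rhs : ∀ p q r → q * (r * 1) + (p * (r * 1) + (p * (q * 1) + 0)) + 1 ≡
      q * r + p * r + p * q + 1
    rhs = ℕ-Solver.solve-∀
  v₁-size : v (suc zero) ≡ (q ∸ 1) * (p + r ∸ 1)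
  -- The excluded prime is passed first.
  v₁-size = nonemptyWithout-size q p r (0< qPrime) (0< pPrime) (0< rPrime)
    (trans (lhs (v (suc zero)) p q r) (trans (v≡ (suc zero)) (rhs p q r)))
    where
    lhs : ∀ v p q r → v + (q + p + r + p * r) ≡
      v + (p * 1 + (q * 1 + (r * 1 + 0)) + p * (r * 1))
    lhs = ℕ-Solver.solve-∀
    rhs : ∀ p q r → q * (r * 1) + (p * (r * 1) + (p * (q * 1) + 0)) + 1 ≡
      p * r + q * r + q * p + 1
    rhs = ℕ-Solver.solve-∀
  v₂-size : v (suc (suc zero)) ≡ (r ∸ 1) * (p + q ∸ 1)
  v₂-size = nonemptyWithout-size r p q (0< rPrime) (0< pPrime) (0< qPrime)
    (trans (lhs (v (suc (suc zero))) p q r) (trans (v≡ (suc (suc zero))) (rhs p q r)))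
    where
    lhs : ∀ v p q r → v + (r + p + q + p * q) ≡
      v + (p * 1 + (q * 1 + (r * 1 + 0)) + p * (q * 1))
    lhs = ℕ-Solver.solve-∀
    rhs : ∀ p q r → q * (r * 1) + (p * (r * 1) + (p * (q * 1) + 0)) + 1 ≡
      p * q + r * q + r * p + 1
    rhs = ℕ-Solver.solve-∀
  -- Only 0 is divisible by all three primes, so `M ⊤` reduces to 1, while `M (∁ ⁅ i ⁆)` is the
  -- prime at position `i`.
  w-step : ∀ i {p} → M (∁ ⁅ i ⁆) ≡ p * 1 → w i + p ≡ v i + 1
  w-step i {p} M≡ = trans (cong (w i +_) (trans (sym (*-identityʳ p)) (sym M≡))) (w≡ i)
  w₀-size : w zero ≡ (p ∸ 1) * (q + r ∸ 2)
  w₀-size = singletonWithout-size p q r (0< pPrime) (0< qPrime) (0< rPrime)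
    (w-step zero refl) v₀-size
  w₁-size : w (suc zero) ≡ (q ∸ 1) * (p + r ∸ 2)
  w₁-size = singletonWithout-size q p r (0< qPrime) (0< pPrime) (0< rPrime)
    (w-step (suc zero) refl) v₁-size
  w₂-size : w (suc (suc zero)) ≡ (r ∸ 1) * (p + q ∸ 2)
  w₂-size = singletonWithout-size r p q (0< rPrime) (0< pPrime) (0< qPrime)
    (w-step (suc (suc zero)) refl) v₂-size
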